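{- Let $G$ be a finite simple undirected $2$-connected graph of order $n$ with degree sequence $d_1\le d_2\le\ldots\le d_n$ and minimum degree $\delta=d_1$, where $\delta\le n-2$ (so that the term $d_{\delta+2}$ is defined). Let $c$ be the order of a longest cycle in $G$ and $p$ the order of a longest path in $G$. Then $c\ge\min\{p,\,d_\delta+d_{\delta+2},\,2d_{\delta+1}\}$.
   Context: Graphs are finite and undirected, with neither loops nor multiple edges. The order $n$ of $G$ is its number of vertices. A graph is $2$-connected if its vertex connectivity is at least $2$ (in particular it has at least $3$ vertices). The degree sequence $d_1\le d_2\le\ldots\le d_n$ lists the degrees of all $n$ vertices of $G$ in nondecreasing order, indexed from $1$; its first term $d_1$ is the minimum degree of $G$, denoted $\delta$. Thus $d_\delta$, $d_{\delta+1}$, $d_{\delta+2}$ are the $\delta$-th, $(\delta+1)$-th and $(\delta+2)$-th terms of this sequence. The order of a cycle or path is its number of vertices. -}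

module Defs where

open import Data.Fin.Base using (Fin)
open import Data.Fin.Subset using (Subset; ∣_∣; _∉_)
open import Data.List.Base using (List; []; _∷_; _∷ʳ_; length; map; filter; allFin)
open import Data.List.Relation.Unary.Linked using (Linked)
open import Data.List.Relation.Unary.Unique.Propositional using (Unique)
open import Data.List.Sort using (sort)
open import Data.Nat.Base using (ℕ; zero; suc; _≤_; _<_)
open import Data.Nat.Properties using (≤-decTotalOrder)
open import Data.Product.Base using (_×_; ∃-syntax)
open import Level using (0ℓ)
open import Relation.Binary.Core using (Rel)
open import Relation.Binary.Construct.Closure.ReflexiveTransitive using (Star)
open import Relation.Binary.Definitions using (Decidable; Symmetric; Irreflexive)
open import Relation.Binary.PropositionalEquality using (_≡_)

record Graph (n : ℕ) : Set₁ where
  field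
    Adj    : Rel (Fin n) 0ℓ
    adj?   : Decidable Adj
    sym    : Symmetric Adj
    irrefl : Irreflexive _≡_ Adj

open Graph public

module _ {n : ℕ} (G : Graph n) where

  degree : Fin n → ℕ
  degree v = length (filter (adj? G v) (allFin n))

  degreeSequence : List ℕ
  degreeSequence = sort ≤-decTotalOrder (map degree (allFin n))

-- The terms of a list, indexed from 1; outside 1 , … , length xs the value
-- is a junk 0.
term : List ℕ → ℕ → ℕ
term []       _             = 0
term (x ∷ xs) zero          = 0
term (x ∷ xs) (suc zero)    = x
term (x ∷ xs) (suc (suc i)) = term xs (suc i)

module _ {n : ℕ} (G : Graph n) where

  d : ℕ → ℕ
  d = term (degreeSequence G)

  δ : ℕ
  δ = d 1

  -- Adjacency in the induced subgraph G − S, on the vertices outside S.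
  AdjOutside : Subset n → Rel (Fin n) 0ℓ
  AdjOutside S u v = u ∉ S × v ∉ S × Adj G u v

  ConnectedOutside : Subset n → Set
  ConnectedOutside S = ∀ u v → u ∉ S → v ∉ S → Star (AdjOutside S) u v

  -- More than k vertices, and deleting fewer than k of them never disconnects G.
  KConnected : ℕ → Set
  KConnected k = k < n × (∀ (S : Subset n) → ∣ S ∣ < k → ConnectedOutside S)

  -- The vertex connectivity is the greatest such k.  In particular it is
  -- n ∸ 1 for the complete graph on n ≥ 1 vertices.
  IsVertexConnectivity : ℕ → Set
  IsVertexConnectivity κ = KConnected κ × (∀ k → KConnected k → k ≤ κ)

  TwoConnected : Set
  TwoConnected = ∃[ κ ] IsVertexConnectivity κ × 2 ≤ κ

  -- Paths and cycles are given by the list of their vertices, each occurring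
  -- once, so that their order is the length of the list.
  data IsPath : List (Fin n) → Set where
    path : ∀ {v vs} → Unique (v ∷ vs) → Linked (Adj G) (v ∷ vs) →
           IsPath (v ∷ vs)

  data IsCycle : List (Fin n) → Set where
    cycle : ∀ {v vs} → 3 ≤ length (v ∷ vs) → Unique (v ∷ vs) →
            Linked (Adj G) ((v ∷ vs) ∷ʳ v) → IsCycle (v ∷ vs)

  IsLongestPathOrder : ℕ → Set
  IsLongestPathOrder p = (∃[ vs ] IsPath vs × length vs ≡ p)
                       × (∀ vs → IsPath vs → length vs ≤ p)

  IsLongestCycleOrder : ℕ → Set
  IsLongestCycleOrder c = (∃[ vs ] IsCycle vs × length vs ≡ c)
                        × (∀ vs → IsCycle vs → length vs ≤ c)

module Submission where

-- Suppose the longest cycle is shorter than the bound, and let v 0 , … , v q be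
-- a longest path whose ends have the largest possible degree sum.  Rotating the
-- path at either end (if v 0 ~ v (suc j), then v j is an end of another longest
-- path) yields as many possible ends as the degree of the rotated end, none of
-- larger degree than that end; counting these small degrees shows that
-- (d_δ + d_{δ+2}) ⊓ 2 d_{δ+1} is at most deg (v 0) + deg (v q).
--
-- It remains to find a cycle through the whole path or of order at least
-- deg (v 0) + deg (v q).  If v 0 ~ v i and v q ~ v j with j < i, take such a
-- crossing pair with i − j minimal: v j … v 0 v i … v q closes up, and it misses
-- only vertices between j and i, where neither end has a neighbour; so the
-- neighbours of v 0 and the successors of those of v q, which are disjoint if
-- the cycle is not the whole path, are no more numerous than its vertices.
-- Without crossing pairs, 2-connectedness gives a chain of overlapping ears
-- from v 0 to v q; when every ear reaches as far as possible they are disjoint,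
-- and the cycle they form contains both ends and all their neighbours.

open import Defs hiding (sym)
open import Data.Empty using (⊥; ⊥-elim)
open import Data.Fin.Base using (Fin)
open import Data.Fin.Properties using (_≟_)
open import Data.Fin.Subset using (⁅_⁆)
open import Data.Fin.Subset.Properties using (∣⁅x⁆∣≡1; x≢y⇒x∉⁅y⁆; x∉⁅y⁆⇒x≢y)
open import Data.List.Base
  using (List; []; _∷_; _++_; [_]; _∷ʳ_; length; map; filter; upTo; applyUpTo; allFin; reverse)
open import Data.List.Membership.DecPropositional using (_∈?_)
open import Data.List.Membership.Propositional using (_∈_; _∉_)
open import Data.List.Membership.Propositional.Properties
  using (∈-∃++; ∈-++⁺ˡ; ∈-++⁺ʳ; ∈-++⁻; ∈-map⁺; ∈-map⁻; ∈-filter⁺; ∈-filter⁻; ∈-allFin; ∈-upTo⁺;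
         ∈-upTo⁻; ∈-applyUpTo⁺)
open import Data.List.Properties
  using (length-++; length-map; length-filter; length-reverse; length-tabulate; length-applyUpTo;
         filter-accept; filter-reject; unfold-reverse)
open import Data.List.Relation.Binary.Disjoint.Propositional using (Disjoint)
open import Data.List.Relation.Binary.Permutation.Propositional.Properties using (filter-↭; ↭-length)
open import Data.List.Relation.Binary.Subset.Propositional using (_⊆_)
open import Data.List.Relation.Unary.All as All using ([]; _∷_)
open import Data.List.Relation.Unary.All.Properties using (¬Any⇒All¬; All¬⇒¬Any)
open import Data.List.Relation.Unary.AllPairs using ([]; _∷_)
open import Data.List.Relation.Unary.Any using (here; there)
open import Data.List.Relation.Unary.Any.Properties using (reverse⁺; reverse⁻)
open import Data.List.Relation.Unary.Linked using (Linked; [-]; _∷_; tail)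
open import Data.List.Relation.Unary.Linked.Properties using (Linked⇒All)
open import Data.List.Relation.Unary.Unique.Propositional using (Unique)
open import Data.List.Relation.Unary.Unique.Propositional.Properties
  using (allFin⁺; upTo⁺; map⁺; ++⁺; filter⁺; Unique[x∷xs]⇒x∉xs)
open import Data.List.Sort using (sort-↭; sort-↗)
open import Data.Nat.Base
  using (ℕ; zero; suc; _+_; _*_; _∸_; pred; _⊓_; _≤_; _<_; _≥_; z≤n; s≤s; s≤s⁻¹; >-nonZero)
open import Data.Nat.Induction using (<-rec)
open import Data.Nat.Properties hiding (_≟_)
open import Data.Product.Base using (_×_; _,_; ∃-syntax; proj₁; proj₂)
open import Data.Sum.Base using (_⊎_; inj₁; inj₂)
open import Function.Base using (_∘_; id)
open import Relation.Binary.Construct.Closure.ReflexiveTransitive using (Star; ε; _◅_)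
open import Relation.Binary.Definitions using (tri<; tri≈; tri>)
open import Relation.Binary.PropositionalEquality as ≡
  using (_≡_; _≢_; refl; cong; cong₂; subst; sym; module ≡-Reasoning)
open import Relation.Nullary using (¬_; Dec; yes; no; ¬?)

-- Counting by duplicate-free lists, and extremal choice.

module _ {A : Set} where

  ⊆⇒length≤ : ∀ {xs ys : List A} → Unique xs → xs ⊆ ys → length xs ≤ length ys
  ⊆⇒length≤ {[]}     _         _   = z≤n
  ⊆⇒length≤ {x ∷ xs} (x∉ ∷ u) sub with as , bs , refl ← ∈-∃++ (sub (here refl)) = begin
    suc (length xs)               ≤⟨ s≤s (⊆⇒length≤ u sub′) ⟩
    suc (length (as ++ bs))       ≡⟨ cong suc (length-++ as) ⟩
    suc (length as + length bs)   ≡⟨ +-suc (length as) (length bs) ⟨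
    length as + suc (length bs)   ≡⟨ length-++ as ⟨
    length (as ++ x ∷ bs)         ∎
    where
    open ≤-Reasoning
    sub′ : xs ⊆ as ++ bs
    sub′ w∈ with ∈-++⁻ as (sub (there w∈))
    ... | inj₁ w∈as           = ∈-++⁺ˡ w∈as
    ... | inj₂ (here refl)    = ⊥-elim (Unique[x∷xs]⇒x∉xs (x∉ ∷ u) w∈)
    ... | inj₂ (there w∈bs)   = ∈-++⁺ʳ as w∈bs

  Unique-map-on : ∀ {B : Set} (f : A → B) {xs} →
                  (∀ {x y} → x ∈ xs → y ∈ xs → f x ≡ f y → x ≡ y) → Unique xs → Unique (map f xs)
  Unique-map-on f {[]}     inj []       = []
  Unique-map-on f {x ∷ xs} inj (x∉ ∷ u) =
    ¬Any⇒All¬ _ fx∉ ∷ Unique-map-on f (λ a b → inj (there a) (there b)) u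
    where
    fx∉ : f x ∉ map f xs
    fx∉ fx∈ with y , y∈ , e ← ∈-map⁻ f fx∈ with refl ← inj (here refl) (there y∈) e =
      Unique[x∷xs]⇒x∉xs (x∉ ∷ u) y∈

-- Least-element principle in refutational form: with goal `⊥`, a least witness may be assumed
-- without deciding `P`. Bridges, vines and longest paths are chosen this way, here or through
-- `noMaximal`.
noMinimal : ∀ {P : ℕ → Set} → (∀ k → P k → (∀ {j} → j < k → ¬ P j) → ⊥) → ∀ k → ¬ P k
noMinimal step = <-rec _ (λ k rec pk → step k pk (λ j<k → rec j<k))

noMaximal : ∀ {P : ℕ → Set} N → (∀ {k} → P k → k ≤ N) →
            (∀ k → P k → (∀ {j} → k < j → ¬ P j) → ⊥) → ∀ k → ¬ P k
noMaximal {P} N bound step k pk =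
  noMinimal {λ j → ∃[ i ] P i × N ∸ i ≡ j}
    (λ { _ (i , pi , refl) rec →
         step i pi (λ {j} i<j pj → rec (∸-monoʳ-< i<j (bound pj)) (j , pj , refl)) })
    (N ∸ k) (k , pk , refl)

nonempty-filter : ∀ {A : Set} {P : A → Set} (P? : ∀ x → Dec (P x)) xs →
                  0 < length (filter P? xs) → ∃[ x ] x ∈ xs × P x
nonempty-filter P? xs h with filter P? xs in eq
... | x ∷ _ = x , ∈-filter⁻ P? {xs = xs} (subst (x ∈_) (sym eq) (here refl))

length-filter-map : ∀ {A B : Set} (f : A → B) {P : B → Set} (P? : ∀ x → Dec (P x)) xs →
                    length (filter P? (map f xs)) ≡ length (filter (P? ∘ f) xs)
length-filter-map f P? []       = refl
length-filter-map f P? (x ∷ xs) with P? (f x)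
... | yes _ = cong suc (length-filter-map f P? xs)
... | no  _ = length-filter-map f P? xs

-- Turns a count of small entries into a bound on a sorted term: dropping the head loses at most one
-- entry that is `≤ D`.
term-≤ : ∀ D k {xs} → Linked _≤_ xs → k ≤ length (filter (_≤? D) xs) → term xs k ≤ D
term-≤ D _             {[]}     _      _ = z≤n
term-≤ D zero          {_ ∷ _}  _      _ = z≤n
term-≤ D (suc zero)    {x ∷ xs} sorted h
  with y , y∈xs , y≤D ← nonempty-filter (_≤? D) (x ∷ xs) h =
  ≤-trans (All.lookup (Linked⇒All ≤-trans ≤-refl sorted) y∈xs) y≤D
term-≤ D (suc (suc k)) {x ∷ xs} sorted h = term-≤ D (suc k) (tail sorted) (drop-one h)
  where
  drop-one : suc (suc k) ≤ length (filter (_≤? D) (x ∷ xs)) → suc k ≤ length (filter (_≤? D) xs)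
  drop-one h with x ≤? D
  ... | yes x≤D rewrite filter-accept (_≤? D) {xs = xs} x≤D = s≤s⁻¹ h
  ... | no  x≰D rewrite filter-reject (_≤? D) {xs = xs} x≰D = <⇒≤ h

-- Degrees and terms of the degree sequence.

module _ {n : ℕ} (G : Graph n) where

  private
    infix 4 _~_

    _~_ : Fin n → Fin n → Set
    _~_ = Adj G

    ~-sym : ∀ {x y} → x ~ y → y ~ x
    ~-sym = Graph.sym G

    deg : Fin n → ℕ
    deg = degree G

  neighbours : Fin n → List (Fin n)
  neighbours x = filter (adj? G x) (allFin n)

  neighbours-unique : ∀ x → Unique (neighbours x)
  neighbours-unique x = filter⁺ (adj? G x) (allFin⁺ n)

  ∈-neighbours⁻ : ∀ {x w} → w ∈ neighbours x → x ~ w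
  ∈-neighbours⁻ {x} = proj₂ ∘ ∈-filter⁻ (adj? G x) {xs = allFin n}

  degree≤n : ∀ x → deg x ≤ n
  degree≤n x = ≤-trans (length-filter (adj? G x) (allFin n)) (≤-reflexive (length-tabulate id))

  -- Sorting permutes the degrees, so it preserves the number of those at most `D`, to which each
  -- entry of `vs` contributes one.
  d-≤ : ∀ D k {vs} → Unique vs → (∀ {w} → w ∈ vs → deg w ≤ D) → k ≤ length vs → d G k ≤ D
  d-≤ D k {vs} u small k≤ = term-≤ D k (sort-↗ ≤-decTotalOrder _) (begin
    k                                             ≤⟨ k≤ ⟩
    length vs                                     ≤⟨ ⊆⇒length≤ u sub ⟩
    length (filter (λ w → deg w ≤? D) (allFin n)) ≡⟨ length-filter-map deg (_≤? D) (allFin n) ⟨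
    length (filter (_≤? D) (map deg (allFin n)))  ≡⟨ ↭-length (filter-↭ (_≤? D) (sort-↭ ≤-decTotalOrder _)) ⟨
    length (filter (_≤? D) (degreeSequence G))    ∎)
    where
    open ≤-Reasoning
    sub : vs ⊆ filter (λ w → deg w ≤? D) (allFin n)
    sub w∈ = ∈-filter⁺ (λ w → deg w ≤? D) (∈-allFin _) (small w∈)

  δ≤degree : ∀ x → δ G ≤ deg x
  δ≤degree x = d-≤ (deg x) 1 {[ x ]} ([] ∷ []) (λ { (here refl) → ≤-refl }) ≤-refl

  degreeBound : ℕ
  degreeBound = (d G (δ G) + d G (δ G + 2)) ⊓ (2 * d G (δ G + 1))

  -- Paths with named ends.

  data Path : Fin n → Fin n → List (Fin n) → Set where
    [-]  : ∀ {a} → Path a a [ a ]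
    step : ∀ {a b c xs} → a ~ b → a ∉ xs → Path b c xs → Path a c (a ∷ xs)

  path-unique : ∀ {a b xs} → Path a b xs → Unique xs
  path-unique [-]            = [] ∷ []
  path-unique (step _ a∉ P)  = ¬Any⇒All¬ _ a∉ ∷ path-unique P

  path-head : ∀ {a b c xs} → Path a b (c ∷ xs) → a ≡ c
  path-head [-]          = refl
  path-head (step _ _ _) = refl

  join : ∀ {a b a′ b′ xs ys} →
         Path a b xs → b ~ a′ → Path a′ b′ ys → Disjoint xs ys → Path a b′ (xs ++ ys)
  join [-]                 b~c Q dis = step b~c (λ ∈ys → dis (here refl , ∈ys)) Q
  join {xs = a ∷ xs} {ys = ys} (step a~ a∉ P) b~c Q dis =
    step a~ a∉′ (join P b~c Q (λ (p , q) → dis (there p , q)))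
    where
    a∉′ : a ∉ xs ++ ys
    a∉′ a∈ with ∈-++⁻ xs a∈
    ... | inj₁ a∈xs = a∉ a∈xs
    ... | inj₂ a∈ys = dis (here refl , a∈ys)

  reversed : ∀ {a b xs} → Path a b xs → Path b a (reverse xs)
  reversed [-] = [-]
  reversed {xs = a ∷ xs} (step a~ a∉ P) =
    subst (Path _ _) (sym (unfold-reverse a xs))
      (join (reversed P) (~-sym a~) [-] λ { (p , here refl) → a∉ (reverse⁻ p) })

  path-linked : ∀ {a b xs} → Path a b xs → Linked _~_ xs
  path-linked [-]                              = [-]
  path-linked (step a~b _ [-])                 = a~b ∷ [-]
  path-linked (step a~b _ P@(step _ _ _))      = a~b ∷ path-linked P

  closed-linked : ∀ {a b c xs} → Path a b xs → b ~ c → Linked _~_ (xs ∷ʳ c)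
  closed-linked [-]                         b~c = b~c ∷ [-]
  closed-linked (step a~b _ [-])            b~c = a~b ∷ b~c ∷ [-]
  closed-linked (step a~b _ P@(step _ _ _)) b~c = a~b ∷ closed-linked P b~c

  path⇒IsPath : ∀ {a b xs} → Path a b xs → IsPath G xs
  path⇒IsPath P@([-])        = path (path-unique P) (path-linked P)
  path⇒IsPath P@(step _ _ _) = path (path-unique P) (path-linked P)

  path⇒IsCycle : ∀ {a b xs} → Path a b xs → b ~ a → 3 ≤ length xs → IsCycle G xs
  path⇒IsCycle P@([-])        b~a 3≤ = cycle 3≤ (path-unique P) (closed-linked P b~a)
  path⇒IsCycle P@(step _ _ _) b~a 3≤ = cycle 3≤ (path-unique P) (closed-linked P b~a)

  toPath : ∀ {v vs} → Unique (v ∷ vs) → Linked _~_ (v ∷ vs) → ∃[ w ] Path v w (v ∷ vs)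
  toPath {v} {[]}     _        _          = v , [-]
  toPath {v} {w ∷ vs} (v∉ ∷ u) (v~w ∷ l)
    with z , P ← toPath u l = z , step v~w (All¬⇒¬Any v∉) P

  -- Segments of a path given by positions.

  module _ (q : ℕ) (v : ℕ → Fin n)
           (v-injective : ∀ {i j} → i ≤ q → j ≤ q → v i ≡ v j → i ≡ j)
           (v-adjacent  : ∀ {i} → i < q → v i ~ v (suc i)) where

    down : ℕ → ℕ → List (Fin n)
    down u zero    = [ v u ]
    down u (suc k) = v (suc (k + u)) ∷ down u k

    ∈-down⁻ : ∀ {w} u k → w ∈ down u k → ∃[ i ] u ≤ i × i ≤ k + u × v i ≡ w
    ∈-down⁻ u zero    (here refl) = u , ≤-refl , ≤-refl , refl
    ∈-down⁻ u (suc k) (here refl) = suc (k + u) , m≤n⇒m≤1+n (m≤n+m u k) , ≤-refl , refl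
    ∈-down⁻ u (suc k) (there w∈)
      with i , u≤i , i≤ , e ← ∈-down⁻ u k w∈ = i , u≤i , m≤n⇒m≤1+n i≤ , e

    ∈-down⁺ : ∀ {i} u k → u ≤ i → i ≤ k + u → v i ∈ down u k
    ∈-down⁺ u zero    u≤i i≤ = here (cong v (≤-antisym i≤ u≤i))
    ∈-down⁺ u (suc k) u≤i i≤ with m≤n⇒m<n∨m≡n i≤
    ... | inj₁ i<   = there (∈-down⁺ u k u≤i (s≤s⁻¹ i<))
    ... | inj₂ refl = here refl

    down-path : ∀ u k → k + u ≤ q → Path (v (k + u)) (v u) (down u k)
    down-path u zero    _  = [-]
    down-path u (suc k) k≤ = step (~-sym (v-adjacent k≤)) fresh (down-path u k (<⇒≤ k≤))
      where
      fresh : v (suc (k + u)) ∉ down u k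
      fresh w∈ with i , _ , i≤ , e ← ∈-down⁻ u k w∈ =
        <⇒≢ (s≤s i≤) (v-injective (≤-trans i≤ (<⇒≤ k≤)) k≤ e)

    length-down : ∀ u k → length (down u k) ≡ suc k
    length-down u zero    = refl
    length-down u (suc k) = cong suc (length-down u k)

    -- Read downwards, from position `s` to position `u`; for `s < u` truncated subtraction gives
    -- the junk value `[ v u ]`.
    segment : ℕ → ℕ → List (Fin n)
    segment s u = down u (s ∸ u)

    segment-path : ∀ {s u} → u ≤ s → s ≤ q → Path (v s) (v u) (segment s u)
    segment-path {s} {u} u≤s s≤q =
      subst (λ i → Path (v i) (v u) (segment s u)) (m∸n+n≡m u≤s)
        (down-path u (s ∸ u) (≤-trans (≤-reflexive (m∸n+n≡m u≤s)) s≤q))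

    ∈-segment⁺ : ∀ {s u i} → u ≤ i → i ≤ s → v i ∈ segment s u
    ∈-segment⁺ {s} {u} u≤i i≤s =
      ∈-down⁺ u (s ∸ u) u≤i (≤-trans i≤s (≤-reflexive (sym (m∸n+n≡m (≤-trans u≤i i≤s)))))

    ∈-segment⁻ : ∀ {s u w} → u ≤ s → w ∈ segment s u → ∃[ i ] u ≤ i × i ≤ s × v i ≡ w
    ∈-segment⁻ {s} {u} u≤s w∈ with i , u≤i , i≤ , e ← ∈-down⁻ u (s ∸ u) w∈ =
      i , u≤i , ≤-trans i≤ (≤-reflexive (m∸n+n≡m u≤s)) , e

    segments-disjoint : ∀ {s u s′ u′} → u ≤ s → s < u′ → u′ ≤ s′ → s′ ≤ q →
                        Disjoint (segment s u) (segment s′ u′)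
    segments-disjoint u≤s s<u′ u′≤s′ s′≤q (p , p′)
      with i , _ , i≤s , refl ← ∈-segment⁻ u≤s p
         | j , u′≤j , j≤s′ , e ← ∈-segment⁻ u′≤s′ p′ =
      <⇒≢ (≤-<-trans i≤s (≤-trans s<u′ u′≤j))
        (v-injective (≤-trans i≤s (≤-trans (<⇒≤ s<u′) (≤-trans u′≤s′ s′≤q))) (≤-trans j≤s′ s′≤q) (sym e))

    -- Ears off the path, and bridges between two of its positions.

    Off : Fin n → Set
    Off w = ∀ {i} → i ≤ q → v i ≢ w

    locate : ∀ w → (∃[ i ] i ≤ q × v i ≡ w) ⊎ Off w
    locate w with anyUpTo? (λ i → v i ≟ w) (suc q)
    ... | yes (i , i<1+q , e) = inj₁ (i , s≤s⁻¹ i<1+q , e)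
    ... | no  none            = inj₂ (λ i≤q e → none (_ , s≤s i≤q , e))

    -- Ear s e Q: the list Q is a path from e, internally disjoint from v, whose
    -- last vertex is adjacent to v s; v s itself is omitted, and Q is empty
    -- when e = v s.
    data Ear (s : ℕ) : Fin n → List (Fin n) → Set where
      root : Ear s (v s) []
      grow : ∀ {w w′ Q} → w′ ~ w → Off w′ → w′ ∉ Q → Ear s w Q → Ear s w′ (w′ ∷ Q)

    ear-off : ∀ {s e Q w} → Ear s e Q → w ∈ Q → Off w
    ear-off (grow _ off _ _) (here refl) = off
    ear-off (grow _ _ _ E)   (there w∈)  = ear-off E w∈

    ear-suffix : ∀ {s e Q w} → Ear s e Q → w ∈ Q → ∃[ Q′ ] Ear s w Q′
    ear-suffix E@(grow _ _ _ _) (here refl) = _ , E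
    ear-suffix (grow _ _ _ E)   (there w∈)  = ear-suffix E w∈

    -- Cuts loops while a walk is traced: if `w′` is already on the ear, the suffix starting there
    -- is taken instead.
    ear-extend : ∀ {s w w′ Q} → Ear s w Q → w′ ~ w → Off w′ → ∃[ Q′ ] Ear s w′ Q′
    ear-extend {w′ = w′} {Q} E w′~w off with _∈?_ _≟_ w′ Q
    ... | yes w′∈ = ear-suffix E w′∈
    ... | no  w′∉ = _ , grow w′~w off w′∉ E

    -- Follows the first ear from `e` to `w`, then the second to `v s′`. Thus an ear that meets
    -- another one also has a version with the other's foot.
    ear-splice : ∀ {s s′ e Q w Q′} → Ear s e Q → w ∈ Q → Ear s′ w Q′ → ∃[ Q″ ] Ear s′ e Q″
    ear-splice (grow _ _ _ _)       (here refl) E′ = _ , E′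
    ear-splice (grow w′~w off _ E)  (there w∈)  E′ with _ , E″ ← ear-splice E w∈ E′ =
      ear-extend E″ w′~w off

    ear-join : ∀ {s e b Q zs} → Ear s e Q → Path (v s) b zs → Disjoint Q zs → Path e b (Q ++ zs)
    ear-join root                         P _   = P
    ear-join {zs = zs} (grow {w′ = w′} {Q} w′~w _ w′∉ E) P dis =
      step w′~w w′∉′ (ear-join E P (λ (p , p′) → dis (there p , p′)))
      where
      w′∉′ : w′ ∉ Q ++ zs
      w′∉′ w′∈ with ∈-++⁻ Q w′∈
      ... | inj₁ w′∈Q  = w′∉ w′∈Q
      ... | inj₂ w′∈zs = dis (here refl , w′∈zs)

    -- The `root` ear makes a plain edge a bridge too, so chords and detours off the path are
    -- treated alike.
    Bridge : ℕ → ℕ → Set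
    Bridge s t = ∃[ e ] ∃[ Q ] Ear s e Q × e ~ v t

    edge-bridge : ∀ {s t} → v s ~ v t → Bridge s t
    edge-bridge s~t = _ , _ , root , s~t

    module _ (avoiding : ∀ {w a b} → a ≢ w → b ≢ w → Star (AdjOutside G ⁅ w ⁆) a b) where

      -- Traces a walk from `v 0` to `v q` that avoids `v t`. `go` carries an ear back to the path
      -- vertex visited last, at a position below `t`; the first landing beyond `t` completes the
      -- bridge.
      bridge-over : ∀ {t} → 0 < t → t < q → ∃[ s ] ∃[ t′ ] s < t × t < t′ × t′ ≤ q × Bridge s t′
      bridge-over {t} 0<t t<q = go root 0<t
        (avoiding (λ e → <⇒≢ 0<t (v-injective z≤n (<⇒≤ t<q) e))
                  (λ e → <⇒≢ t<q (sym (v-injective ≤-refl (<⇒≤ t<q) e)))) refl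
        where
        go : ∀ {s w w′ Q} → Ear s w Q → s < t → Star (AdjOutside G ⁅ v t ⁆) w w′ → w′ ≡ v q →
             ∃[ s ] ∃[ t′ ] s < t × t < t′ × t′ ≤ q × Bridge s t′
        go root               s<t ε e =
          ⊥-elim (<⇒≢ (<-trans s<t t<q) (v-injective (<⇒≤ (<-trans s<t t<q)) ≤-refl e))
        go (grow _ off _ _)   _   ε e = ⊥-elim (off ≤-refl (sym e))
        go E s<t (_◅_ {j = w₁} (_ , w₁∉ , w~w₁) rest) e with locate w₁
        ... | inj₂ off = go (proj₂ (ear-extend E (~-sym w~w₁) off)) s<t rest e
        ... | inj₁ (i , i≤q , refl) with <-cmp i t
        ...   | tri< i<t _ _  = go root i<t rest e
        ...   | tri≈ _ refl _ = ⊥-elim (x∉⁅y⁆⇒x≢y w₁∉ refl)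
        ...   | tri> _ _ t<i  = _ , i , s<t , t<i , i≤q , _ , _ , E , w~w₁

    -- Neighbour positions and rotations.

    indices : Fin n → List ℕ
    indices x = filter (λ k → adj? G x (v k)) (upTo (suc q))

    indices-unique : ∀ x → Unique (indices x)
    indices-unique x = filter⁺ (λ k → adj? G x (v k)) (upTo⁺ (suc q))

    ∈-indices⁻ : ∀ {x k} → k ∈ indices x → k ≤ q × x ~ v k
    ∈-indices⁻ {x} k∈ with k∈upTo , x~k ← ∈-filter⁻ (λ k → adj? G x (v k)) {xs = upTo (suc q)} k∈ =
      s≤s⁻¹ (∈-upTo⁻ k∈upTo) , x~k

    degree≤indices : ∀ {x} → (∀ {w} → x ~ w → ∃[ i ] i ≤ q × v i ≡ w) → deg x ≤ length (indices x)
    degree≤indices {x} closed = begin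
      length (neighbours x)      ≤⟨ ⊆⇒length≤ (neighbours-unique x) sub ⟩
      length (map v (indices x)) ≡⟨ length-map v (indices x) ⟩
      length (indices x)         ∎
      where
      open ≤-Reasoning
      sub : neighbours x ⊆ map v (indices x)
      sub w∈ with i , i≤q , refl ← closed (∈-neighbours⁻ w∈) =
        ∈-map⁺ v (∈-filter⁺ (λ k → adj? G x (v k)) (∈-upTo⁺ (s≤s i≤q)) (∈-neighbours⁻ w∈))

    ~-irrefl : ∀ {i j} → i ≡ j → ¬ (v i ~ v j)
    ~-irrefl refl = irrefl G refl

    -- The path `v j` ... `v 0`, `v i` ... `v q`. With `i = suc j` it uses every vertex of the
    -- original path; with `v q ~ v j` it closes to a cycle.
    rotation : ∀ {j i} → j < i → i ≤ q → v 0 ~ v i → Path (v j) (v q) (segment j 0 ++ reverse (segment q i))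
    rotation j<i i≤q 0~i =
      join (segment-path z≤n (<⇒≤ (≤-trans j<i i≤q))) 0~i (reversed (segment-path i≤q ≤-refl))
        (λ (p , p′) → segments-disjoint z≤n j<i i≤q ≤-refl (p , reverse⁻ p′))

    length-rotation : ∀ j i → length (segment j 0 ++ reverse (segment q i)) ≡ suc j + suc (q ∸ i)
    length-rotation j i = begin
      length (segment j 0 ++ reverse (segment q i))         ≡⟨ length-++ (segment j 0) ⟩
      length (segment j 0) + length (reverse (segment q i)) ≡⟨ cong₂ _+_ (length-down 0 j)
                                                                     (length-reverse (segment q i)) ⟩
      suc j + length (segment q i)                          ≡⟨ cong (suc j +_) (length-down i (q ∸ i)) ⟩
      suc j + suc (q ∸ i)                                   ∎
      where open ≡-Reasoning

    length-full-rotation : ∀ {j} → j < q → suc j + suc (q ∸ suc j) ≡ suc q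
    length-full-rotation {j} j<q = ≡.trans (+-suc (suc j) _) (cong suc (m+[n∸m]≡n j<q))

    module _ (closedˡ : ∀ {w} → v 0 ~ w → ∃[ i ] i ≤ q × v i ≡ w) where

      -- Pósa rotation: `Z` consists of the predecessors of the neighbours of `v 0`. The fixed end
      -- `v q` is not among them, so that it can later be counted in addition.
      rotation-ends : ∃[ Z ] Unique Z × deg (v 0) ≤ length Z × v q ∉ Z ×
                      (∀ {z} → z ∈ Z → ∃[ xs ] Path z (v q) xs × length xs ≡ suc q)
      rotation-ends = map (v ∘ pred) (indices (v 0))
                    , Unique-map-on (v ∘ pred) injective (indices-unique (v 0))
                    , ≤-trans (degree≤indices closedˡ) (≤-reflexive (sym (length-map _ (indices (v 0)))))
                    , fresh
                    , ends
        where
        predecessor : ∀ {k} → k ∈ indices (v 0) → ∃[ j ] k ≡ suc j × suc j ≤ q × v 0 ~ v (suc j)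
        -- Position 0 has no predecessor, but `v 0` is not its own neighbour.
        predecessor {zero}  k∈ = ⊥-elim (~-irrefl refl (proj₂ (∈-indices⁻ k∈)))
        predecessor {suc j} k∈ = j , refl , ∈-indices⁻ k∈

        injective : ∀ {k l} → k ∈ indices (v 0) → l ∈ indices (v 0) → v (pred k) ≡ v (pred l) → k ≡ l
        injective k∈ l∈ e with i , refl , i<q , _ ← predecessor k∈ | j , refl , j<q , _ ← predecessor l∈ =
          cong suc (v-injective (<⇒≤ i<q) (<⇒≤ j<q) e)

        fresh : v q ∉ map (v ∘ pred) (indices (v 0))
        fresh q∈ with k , k∈ , e ← ∈-map⁻ (v ∘ pred) q∈ with j , refl , j<q , _ ← predecessor k∈ =
          <⇒≢ j<q (sym (v-injective ≤-refl (<⇒≤ j<q) e))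

        ends : ∀ {z} → z ∈ map (v ∘ pred) (indices (v 0)) → ∃[ xs ] Path z (v q) xs × length xs ≡ suc q
        ends z∈ with k , k∈ , refl ← ∈-map⁻ (v ∘ pred) z∈ with j , refl , j<q , 0~ ← predecessor k∈ =
          _ , rotation ≤-refl j<q 0~ , ≡.trans (length-rotation j (suc j)) (length-full-rotation j<q)

      -- Crossing pairs.

      module _ (closedʳ  : ∀ {w} → v q ~ w → ∃[ i ] i ≤ q × v i ≡ w)
               (avoiding : ∀ {w a b} → a ≢ w → b ≢ w → Star (AdjOutside G ⁅ w ⁆) a b)
               {c : ℕ}
               (closed≤c : ∀ {a b xs} → Path a b xs → b ~ a → length xs ≤ c)
               (c<p      : c < suc q)
               (c<sum    : c < deg (v 0) + deg (v q)) where

        -- `g` counts the vertices strictly between the two positions, which are those that the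
        -- closed rotation misses.
        Crossing : ℕ → Set
        Crossing g = ∃[ i ] ∃[ j ] i ≤ q × v 0 ~ v i × v q ~ v j × i ≡ suc g + j

        no-minimal-crossing : ∀ g → Crossing g → (∀ {g′} → g′ < g → ¬ Crossing g′) → ⊥
        -- Nothing is missed: the closed rotation has order `suc q`, more than `c`.
        no-minimal-crossing zero (i , j , i≤q , 0~i , q~j , refl) _ = <⇒≱ c<p (begin
          suc q                     ≡⟨ length-full-rotation i≤q ⟨
          suc j + suc (q ∸ suc j)   ≡⟨ length-rotation j (suc j) ⟨
          length (segment j 0 ++ reverse (segment q (suc j))) ≤⟨ closed≤c (rotation ≤-refl i≤q 0~i) q~j ⟩
          c                         ∎)
          where open ≤-Reasoning
        no-minimal-crossing (suc g) (i , j , i≤q , 0~i , q~j , refl) minimal = <⇒≱ c<sum (begin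
          deg (v 0) + deg (v q)                   ≤⟨ +-mono-≤ (degree≤indices closedˡ) (degree≤indices closedʳ) ⟩
          length I + length J                     ≡⟨ cong (length I +_) (length-map suc J) ⟨
          length I + length (map suc J)           ≡⟨ length-++ I ⟨
          length (I ++ map suc J)                 ≤⟨ ⊆⇒length≤ unique sub ⟩
          length (R ++ R′)                        ≡⟨ length-++ R ⟩
          length R + length R′                    ≡⟨ cong₂ _+_ (length-applyUpTo suc (suc j))
                                                       (length-applyUpTo (i +_) (suc (q ∸ i))) ⟩
          suc j + suc (q ∸ i)                     ≡⟨ length-rotation j i ⟨
          length (segment j 0 ++ reverse (segment q i)) ≤⟨ closed≤c (rotation j<i i≤q 0~i) q~j ⟩
          c                                       ∎)
          where
          open ≤-Reasoning
          I J R R′ : List ℕ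
          I  = indices (v 0)
          J  = indices (v q)
          -- The cycle occupies positions 0 to `j` and `i` to `q`. `R` is the first range shifted up
          -- by one, `R′` the second. The shift fits, since 0 is not in `I` and `q` is not in `J`.
          R  = applyUpTo suc (suc j)
          R′ = applyUpTo (i +_) (suc (q ∸ i))

          j<i : j < i
          j<i = s≤s (m≤n+m j (suc g))

          -- Excludes neighbours of the ends strictly between `j` and `i`: one of `v 0` would pair
          -- with `j`, one of `v q` with `i`, at a smaller distance.
          closer : ∀ {k l} → k ≤ q → v 0 ~ v k → v q ~ v l → l < k → k ∸ l < i ∸ j → ⊥
          closer {k} {l} k≤q 0~k q~l l<k shorter =
            minimal {pred (k ∸ l)}
              (s≤s⁻¹ (≤-trans (≤-reflexive (cong suc 1+gap))
                (≤-trans shorter (≤-reflexive (m+n∸n≡m (suc (suc g)) j)))))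
              (k , l , k≤q , 0~k , q~l , ≡.trans (sym (m∸n+n≡m (<⇒≤ l<k))) (cong (_+ l) (sym 1+gap)))
            where
            1+gap : suc (pred (k ∸ l)) ≡ k ∸ l
            1+gap = suc-pred (k ∸ l) ⦃ >-nonZero (m<n⇒0<n∸m l<k) ⦄

          ∈R : ∀ {k} → k ≤ j → suc k ∈ R
          ∈R k≤j = ∈-applyUpTo⁺ suc (s≤s k≤j)

          ∈R′ : ∀ {k} → i ≤ k → k ≤ q → k ∈ R′
          ∈R′ i≤k k≤q = subst (_∈ R′) (m+[n∸m]≡n i≤k) (∈-applyUpTo⁺ (i +_) (s≤s (∸-monoˡ-≤ i k≤q)))

          disjoint : Disjoint I (map suc J)
          disjoint (k∈I , k∈J) with l , l∈J , refl ← ∈-map⁻ suc k∈J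
            with k≤q , 0~k ← ∈-indices⁻ k∈I | _ , q~l ← ∈-indices⁻ l∈J =
            minimal (s≤s z≤n) (suc l , l , k≤q , 0~k , q~l , refl)

          unique : Unique (I ++ map suc J)
          unique = ++⁺ (indices-unique (v 0)) (map⁺ suc-injective (indices-unique (v q))) disjoint

          sub : I ++ map suc J ⊆ R ++ R′
          sub {k} k∈ with ∈-++⁻ I k∈
          sub {zero}  k∈ | inj₁ k∈I = ⊥-elim (~-irrefl refl (proj₂ (∈-indices⁻ k∈I)))
          sub {suc k} k∈ | inj₁ k∈I with k<q , 0~k ← ∈-indices⁻ k∈I with suc k ≤? j | i ≤? suc k
          ... | yes k<j | _       = ∈-++⁺ˡ (∈R (<⇒≤ k<j))
          ... | no _    | yes i≤k = ∈-++⁺ʳ R (∈R′ i≤k k<q)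
          ... | no k≮j  | no i≰k  =
            ⊥-elim (closer k<q 0~k q~j (≰⇒> k≮j) (∸-monoˡ-< (≰⇒> i≰k) (<⇒≤ (≰⇒> k≮j))))
          sub k∈ | inj₂ k∈J with l , l∈J , refl ← ∈-map⁻ suc k∈J with l≤q , q~l ← ∈-indices⁻ l∈J
            with l ≤? j | i ≤? l
          ... | yes l≤j | _       = ∈-++⁺ˡ (∈R l≤j)
          ... | no _    | yes i≤l =
            ∈-++⁺ʳ R (∈R′ (m≤n⇒m≤1+n i≤l) (≤∧≢⇒< l≤q (λ e → ~-irrefl (sym e) q~l)))
          ... | no l≰j  | no i≰l  =
            ⊥-elim (closer i≤q 0~i q~l (≰⇒> i≰l) (∸-monoʳ-< (≰⇒> l≰j) (<⇒≤ (≰⇒> i≰l))))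

        uncrossed : ∀ {i j} → i ≤ q → v 0 ~ v i → v q ~ v j → i ≤ j
        uncrossed {i} {j} i≤q 0~i q~j with i ≤? j
        ... | yes i≤j = i≤j
        ... | no  i≰j = ⊥-elim (noMinimal no-minimal-crossing (i ∸ suc j)
          (i , j , i≤q , 0~i , q~j , sym (≡.trans (sym (+-suc (i ∸ suc j) j)) (m∸n+n≡m (≰⇒> i≰j)))))

        -- A nonempty ear would give `v q` a neighbour off the path, against `closedʳ`.
        end-bridge : ∀ {s} → Bridge s q → v q ~ v s
        end-bridge (_ , _ , root , s~q)           = ~-sym s~q
        end-bridge (_ , _ , grow _ off _ _ , e~q) with i , i≤q , eq ← closedʳ (~-sym e~q) =
          ⊥-elim (off i≤q eq)

        -- No crossing pairs: vines of overlapping ears.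

        module _ {a} (a≤q : a ≤ q) (0~a : v 0 ~ v a) (a-last : ∀ {i} → i ≤ q → v 0 ~ v i → i ≤ a) where

          end≥a : ∀ {j} → v q ~ v j → a ≤ j
          end≥a = uncrossed a≤q 0~a

          0<a : 0 < a
          0<a = n≢0⇒n>0 (λ e → ~-irrefl (sym e) 0~a)

          a<q : a < q
          a<q = ≤∧≢⇒< a≤q (λ { refl → <⇒≱ 0<a (end≥a (~-sym 0~a)) })

          -- Without crossings the two neighbourhoods share at most `v a`. Removing it from one side
          -- costs one vertex, which `v 0`, lying in neither neighbourhood, makes up for.
          ends-closure-bound : ∀ {x y C} → Path x y C → y ~ x → v 0 ∈ C →
                               (∀ {i} → i ≤ q → v 0 ~ v i → v i ∈ C) →
                               (∀ {j} → j ≤ q → v q ~ v j → v j ∈ C) → ⊥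
          ends-closure-bound {C = C} P y~x 0∈ ˡ∈ ʳ∈ = <⇒≱ c<sum (begin
            deg (v 0) + deg (v q)       ≤⟨ +-monoˡ-≤ _ (⊆⇒length≤ (neighbours-unique (v 0)) left) ⟩
            suc (length N + deg (v q))  ≡⟨ cong suc (length-++ N) ⟨
            length (v 0 ∷ N ++ neighbours (v q)) ≤⟨ ⊆⇒length≤ unique sub ⟩
            length C                    ≤⟨ closed≤c P y~x ⟩
            c                           ∎)
            where
            open ≤-Reasoning
            N : List (Fin n)
            N = filter (λ w → ¬? (w ≟ v a)) (neighbours (v 0))

            left : neighbours (v 0) ⊆ v a ∷ N
            left {w} w∈ with w ≟ v a
            ... | yes refl = here refl
            ... | no  w≢   = there (∈-filter⁺ (λ w → ¬? (w ≟ v a)) w∈ w≢)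

            ∈-N⁻ : ∀ {w} → w ∈ N → v 0 ~ w × w ≢ v a
            ∈-N⁻ w∈ with w∈nb , w≢ ← ∈-filter⁻ (λ w → ¬? (w ≟ v a)) {xs = neighbours (v 0)} w∈ =
              ∈-neighbours⁻ w∈nb , w≢

            disjoint : Disjoint N (neighbours (v q))
            disjoint (w∈N , w∈) with 0~w , w≢ ← ∈-N⁻ w∈N with i , i≤q , refl ← closedˡ 0~w =
              w≢ (cong v (≤-antisym (a-last i≤q 0~w) (end≥a (∈-neighbours⁻ w∈))))

            fresh : v 0 ∉ N ++ neighbours (v q)
            fresh 0∈ with ∈-++⁻ N 0∈
            ... | inj₁ ∈N = ~-irrefl refl (proj₁ (∈-N⁻ ∈N))
            ... | inj₂ ∈J = <⇒≱ 0<a (end≥a (∈-neighbours⁻ ∈J))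

            unique : Unique (v 0 ∷ N ++ neighbours (v q))
            unique = ¬Any⇒All¬ _ fresh
              ∷ ++⁺ (filter⁺ (λ w → ¬? (w ≟ v a)) (neighbours-unique (v 0))) (neighbours-unique (v q)) disjoint

            sub : v 0 ∷ N ++ neighbours (v q) ⊆ C
            sub (here refl) = 0∈
            sub (there w∈) with ∈-++⁻ N w∈
            ... | inj₁ ∈N with 0~w , _ ← ∈-N⁻ ∈N with i , i≤q , refl ← closedˡ 0~w = ˡ∈ i≤q 0~w
            ... | inj₂ ∈J with q~w ← ∈-neighbours⁻ ∈J with j , j≤q , refl ← closedʳ q~w = ʳ∈ j≤q q~w

          Farthest : ℕ → ℕ → Set
          Farthest t t′ = ∀ {s t″} → s < t → t″ ≤ q → Bridge s t″ → t″ ≤ t′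

          -- A vine up to t, spliced into a single path L: extending its ends to
          -- v t and v u gives a path that turns back at v 0 and contains
          -- every neighbour of v 0 below u.  The bound m is the tip of the
          -- previous ear, so that no ear from below m jumps over t.
          record Vine (t : ℕ) : Set where
            field
              {u m} : ℕ
              {z z′} : Fin n
              {L}   : List (Fin n)
              L-path : Path z z′ L
              u≤m   : u ≤ m
              a≤m   : a ≤ m
              m<t   : m < t
              t<q   : t < q
              z~t   : z ~ v t
              z′~u  : z′ ~ v u
              on-L  : ∀ {i} → i ≤ q → v i ∈ L → i < u
              0∈L   : v 0 ∈ L
              cover : ∀ {i} → i < u → v 0 ~ v i → v i ∈ L
              off-L : ∀ {w} → w ∈ L → Off w → ∃[ s ] ∃[ Q ] s < m × Ear s w Q
              far   : Farthest m t

          module _ {t} (V : Vine t) where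
            open Vine V

            u<t : u < t
            u<t = ≤-<-trans u≤m m<t

            -- A foot before `m` would contradict `far`. Hence the next ear starts no earlier than
            -- the tip of the previous one.
            m≤ : ∀ {s t′} → t < t′ → t′ ≤ q → Bridge s t′ → m ≤ s
            m≤ {s} t<t′ t′≤q B with m ≤? s
            ... | yes m≤s = m≤s
            ... | no  m≰s = ⊥-elim (<⇒≱ t<t′ (far (≰⇒> m≰s) t′≤q B))

            segment-L-disjoint : ∀ {r s} → u ≤ r → r ≤ s → s ≤ q → Disjoint (segment s r) L
            segment-L-disjoint u≤r r≤s s≤q (p , p′) with i , r≤i , i≤s , refl ← ∈-segment⁻ r≤s p =
              <⇒≱ (on-L (≤-trans i≤s s≤q) p′) (≤-trans u≤r r≤i)

            -- The new `L` follows the ear from `e` to `v s`, the segment down to `v u`, the edge to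
            -- `z′`, and the old `L` backwards to `z`. As `z ~ v t`, the old tip `t` becomes both
            -- the new `u` and the new `m`.
            extend : ∀ {s t′} → s < t → t < t′ → t′ < q → Bridge s t′ → Farthest t t′ → Vine t′
            extend {s} {t′} s<t t<t′ t′<q B@(e , Q , E , e~t′) farthest = record
              { L-path = ear-join E
                  (join (segment-path u≤s s≤q) (~-sym z′~u) (reversed L-path)
                    (λ (p , p′) → segment-L-disjoint ≤-refl u≤s s≤q (p , reverse⁻ p′)))
                  disjoint
              ; u≤m    = ≤-refl
              ; a≤m    = ≤-trans a≤m (<⇒≤ m<t)
              ; m<t    = t<t′
              ; t<q    = t′<q
              ; z~t    = e~t′
              ; z′~u   = z~t
              ; on-L   = on
              ; 0∈L    = ∈-++⁺ʳ Q (∈-++⁺ʳ (segment s u) (reverse⁺ 0∈L))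
              ; cover  = covers
              ; off-L  = off
              ; far    = farthest
              }
              where
              m≤s : m ≤ s
              m≤s = m≤ t<t′ (<⇒≤ t′<q) B
              u≤s : u ≤ s
              u≤s = ≤-trans u≤m m≤s
              s≤q : s ≤ q
              s≤q = <⇒≤ (<-trans s<t t<q)

              disjoint : Disjoint Q (segment s u ++ reverse L)
              disjoint (w∈Q , w∈) with ∈-++⁻ (segment s u) w∈
              ... | inj₁ w∈S with i , _ , i≤s , eq ← ∈-segment⁻ u≤s w∈S = ear-off E w∈Q (≤-trans i≤s s≤q) eq
              -- If the new ear met an old one, splicing would give a bridge from below `m` to
              -- `t′ > t`, against `far`.
              ... | inj₂ w∈L with s′ , _ , s′<m , E′ ← off-L (reverse⁻ w∈L) (ear-off E w∈Q) =
                <⇒≱ t<t′ (far s′<m (<⇒≤ t′<q) (e , _ , proj₂ (ear-splice E w∈Q E′) , e~t′))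

              on : ∀ {i} → i ≤ q → v i ∈ Q ++ segment s u ++ reverse L → i < t
              on i≤q w∈ with ∈-++⁻ Q w∈
              ... | inj₁ w∈Q = ⊥-elim (ear-off E w∈Q i≤q refl)
              ... | inj₂ w∈′ with ∈-++⁻ (segment s u) w∈′
              ...   | inj₂ w∈L = <-trans (on-L i≤q (reverse⁻ w∈L)) u<t
              ...   | inj₁ w∈S with j , _ , j≤s , eq ← ∈-segment⁻ u≤s w∈S
                with refl ← v-injective (≤-trans j≤s s≤q) i≤q eq = ≤-<-trans j≤s s<t

              covers : ∀ {i} → i < t → v 0 ~ v i → v i ∈ Q ++ segment s u ++ reverse L
              covers {i} i<t 0~i with u ≤? i
              -- Neighbours of `v 0` stop at `a`, and `a ≤ m ≤ s`, so those from `u` on lie on the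
              -- segment.
              ... | yes u≤i = ∈-++⁺ʳ Q (∈-++⁺ˡ (∈-segment⁺ u≤i
                (≤-trans (a-last (<⇒≤ (<-trans i<t t<q)) 0~i) (≤-trans a≤m m≤s))))
              ... | no  u≰i = ∈-++⁺ʳ Q (∈-++⁺ʳ (segment s u) (reverse⁺ (cover (≰⇒> u≰i) 0~i)))

              off : ∀ {w} → w ∈ Q ++ segment s u ++ reverse L → Off w → ∃[ s′ ] ∃[ Q′ ] s′ < t × Ear s′ w Q′
              off w∈ w-off with ∈-++⁻ Q w∈
              ... | inj₁ w∈Q = s , _ , s<t , proj₂ (ear-suffix E w∈Q)
              ... | inj₂ w∈′ with ∈-++⁻ (segment s u) w∈′
              ...   | inj₁ w∈S with j , _ , j≤s , eq ← ∈-segment⁻ u≤s w∈S = ⊥-elim (w-off (≤-trans j≤s s≤q) eq)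
              ...   | inj₂ w∈L with s′ , Q′ , s′<m , E′ ← off-L (reverse⁻ w∈L) w-off =
                s′ , Q′ , <-trans s′<m m<t , E′

            -- The cycle is `v u` ... `v s`, `v q` ... `v t`, then `L` from `z` to `z′`, and back to
            -- `v u`. Since `s` is the last neighbour position of `v q` below `t`, the skipped
            -- stretch between `s` and `t` contains no neighbour of `v q`.
            close : ∀ {s} → s < t → v q ~ v s → (∀ {j} → j < t → v q ~ v j → j ≤ s) → ⊥
            close {s} s<t q~s s-last = ends-closure-bound
              (join (reversed (segment-path u≤s s≤q)) (~-sym q~s)
                (join (segment-path t≤q ≤-refl) (~-sym z~t) L-path
                  (segment-L-disjoint (<⇒≤ u<t) t≤q ≤-refl))
                disjoint)
              z′~u (∈-++⁺ʳ S (∈-++⁺ʳ (segment q t) 0∈L)) left right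
              where
              meets : ∀ {j} → v q ~ v j → m ≤ j
              -- An edge from `v q` to a vertex of the path is itself a bridge over `t`.
              meets q~j = m≤ t<q ≤-refl (edge-bridge (~-sym q~j))
              u≤s : u ≤ s
              u≤s = ≤-trans u≤m (meets q~s)
              s≤q : s ≤ q
              s≤q = <⇒≤ (<-trans s<t t<q)
              t≤q : t ≤ q
              t≤q = <⇒≤ t<q
              S : List (Fin n)
              S = reverse (segment s u)

              disjoint : Disjoint S (segment q t ++ L)
              disjoint (p , p′) with ∈-++⁻ (segment q t) p′
              ... | inj₁ w∈T = segments-disjoint u≤s s<t t≤q ≤-refl (reverse⁻ p , w∈T)
              ... | inj₂ w∈L = segment-L-disjoint ≤-refl u≤s s≤q (reverse⁻ p , w∈L)

              left : ∀ {i} → i ≤ q → v 0 ~ v i → v i ∈ S ++ segment q t ++ L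
              left {i} i≤q 0~i with u ≤? i
              ... | yes u≤i = ∈-++⁺ˡ (reverse⁺ (∈-segment⁺ u≤i
                (≤-trans (a-last i≤q 0~i) (≤-trans a≤m (meets q~s)))))
              ... | no  u≰i = ∈-++⁺ʳ S (∈-++⁺ʳ (segment q t) (cover (≰⇒> u≰i) 0~i))

              right : ∀ {j} → j ≤ q → v q ~ v j → v j ∈ S ++ segment q t ++ L
              right {j} j≤q q~j with t ≤? j
              ... | yes t≤j = ∈-++⁺ʳ S (∈-++⁺ˡ (∈-segment⁺ t≤j j≤q))
              ... | no  t≰j = ∈-++⁺ˡ (reverse⁺ (∈-segment⁺ (≤-trans u≤m (meets q~j)) (s-last (≰⇒> t≰j) q~j)))

          no-farthest-bridge : ∀ {t} →
            (∀ {s t′} → s < t → t < t′ → t′ ≤ q → Bridge s t′ → Farthest t t′ → ⊥) → 0 < t → t < q → ⊥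
          no-farthest-bridge {t} none 0<t t<q
            with s , t′ , s<t , t<t′ , t′≤q , B ← bridge-over avoiding 0<t t<q =
            noMaximal {λ r → t < r × r ≤ q × ∃[ s ] s < t × Bridge s r} q (proj₁ ∘ proj₂)
              (λ { r (t<r , r≤q , s , s<t , B) beyond → none s<t t<r r≤q B
                   λ {_} {t″} s<t t″≤q B → ≮⇒≥ λ r<t″ →
                     beyond r<t″ (<-trans t<r r<t″ , t″≤q , _ , s<t , B) })
              t′ (t<t′ , t′≤q , s , s<t , B)

          -- Take a vine with last possible tip `t` and a farthest bridge over `t`. If it ends
          -- before `v q`, it extends the vine; otherwise it is an edge at `v q`, and the vine
          -- closes.
          no-vine : ∀ t → ¬ Vine t
          no-vine = noMaximal q (<⇒≤ ∘ Vine.t<q) λ t V beyond →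
            no-farthest-bridge (step-vine V beyond)
              (≤-<-trans z≤n (Vine.m<t V)) (Vine.t<q V)
            where
            step-vine : ∀ {t} → Vine t → (∀ {t′} → t < t′ → ¬ Vine t′) →
                        ∀ {s t′} → s < t → t < t′ → t′ ≤ q → Bridge s t′ → Farthest t t′ → ⊥
            step-vine {t} V beyond {s} {t′} s<t t<t′ t′≤q B farthest with m≤n⇒m<n∨m≡n t′≤q
            ... | inj₁ t′<q = beyond t<t′ (extend V s<t t<t′ t′<q B farthest)
            ... | inj₂ refl =
              noMaximal {λ s → s < t × v q ~ v s} t (<⇒≤ ∘ proj₁)
                (λ { r (r<t , q~r) later → close V r<t q~r
                     λ j<t q~j → ≮⇒≥ λ r<j → later r<j (j<t , q~j) })
                s (s<t , end-bridge B)

          -- The edge from `v 0` to `v a` plays the part of a previous ear, so `m` is `a`. `L`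
          -- follows the ear to `v s` and the path down to `v 0`; it will be left for `v u`, the
          -- first neighbour of `v 0` after `s`, so no neighbour is skipped.
          first-vine : ∀ {s t u} → s < a → a < t → t ≤ q → Bridge s t → Farthest a t →
                       s < u → u ≤ a → v 0 ~ v u → (∀ {i} → s < i → i < u → ¬ (v 0 ~ v i)) → Vine t
          first-vine {s} {t} {u} s<a a<t t≤q (e , Q , E , e~t) farthest s<u u≤a 0~u u-first = record
            { L-path = ear-join E (segment-path z≤n s≤q) disjoint
            ; u≤m    = u≤a
            ; a≤m    = ≤-refl
            ; m<t    = a<t
            -- For `t = q` the bridge would be an edge from `v q` to `v s` with `s < a`, crossing
            -- the edge from `v 0` to `v a`.
            ; t<q    = ≤∧≢⇒< t≤q λ { refl → <⇒≱ s<a (end≥a (end-bridge (e , Q , E , e~t))) }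
            ; z~t    = e~t
            ; z′~u   = 0~u
            ; on-L   = on
            ; 0∈L    = ∈-++⁺ʳ Q (∈-segment⁺ z≤n z≤n)
            ; cover  = λ i<u 0~i → ∈-++⁺ʳ Q (∈-segment⁺ z≤n (≮⇒≥ λ s<i → u-first s<i i<u 0~i))
            ; off-L  = off
            ; far    = farthest
            }
            where
            s≤q : s ≤ q
            s≤q = <⇒≤ (<-trans s<a a<q)

            disjoint : Disjoint Q (segment s 0)
            disjoint (w∈Q , w∈S) with i , _ , i≤s , eq ← ∈-segment⁻ {s} z≤n w∈S =
              ear-off E w∈Q (≤-trans i≤s s≤q) eq

            on : ∀ {i} → i ≤ q → v i ∈ Q ++ segment s 0 → i < u
            on i≤q w∈ with ∈-++⁻ Q w∈
            ... | inj₁ w∈Q = ⊥-elim (ear-off E w∈Q i≤q refl)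
            ... | inj₂ w∈S with j , _ , j≤s , eq ← ∈-segment⁻ {s} z≤n w∈S
              with refl ← v-injective (≤-trans j≤s s≤q) i≤q eq = ≤-<-trans j≤s s<u

            off : ∀ {w} → w ∈ Q ++ segment s 0 → Off w → ∃[ s′ ] ∃[ Q′ ] s′ < a × Ear s′ w Q′
            off w∈ w-off with ∈-++⁻ Q w∈
            ... | inj₁ w∈Q = s , _ , s<a , proj₂ (ear-suffix E w∈Q)
            ... | inj₂ w∈S with j , _ , j≤s , eq ← ∈-segment⁻ {s} z≤n w∈S = ⊥-elim (w-off (≤-trans j≤s s≤q) eq)

          no-last-neighbour : ⊥
          no-last-neighbour = no-farthest-bridge (λ {s} {t} s<a a<t t≤q B farthest →
            noMinimal {λ u → s < u × u ≤ a × v 0 ~ v u}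
              (λ { u (s<u , u≤a , 0~u) earlier → no-vine t (first-vine s<a a<t t≤q B farthest s<u u≤a 0~u
                   λ s<i i<u 0~i → earlier i<u (s<i , ≤-trans (<⇒≤ i<u) u≤a , 0~i)) })
              a (s<a , ≤-refl , 0~a))
            0<a a<q

        long-closed-path : 0 < q → ⊥
        long-closed-path 0<q = noMaximal {λ a → a ≤ q × v 0 ~ v a} q proj₁
          (λ { a (a≤q , 0~a) later → no-last-neighbour a≤q 0~a
               λ i≤q 0~i → ≮⇒≥ λ a<i → later a<i (i≤q , 0~i) })
          1 (0<q , v-adjacent 0<q)

  -- From lists to position functions.

  infixl 9 _∷_at_

  -- Positions beyond the end of the list get its last element.
  _∷_at_ : Fin n → List (Fin n) → ℕ → Fin n
  a ∷ _        at zero  = a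
  a ∷ []       at suc i = a
  _ ∷ (b ∷ ys) at suc i = b ∷ ys at i

  at-last : ∀ {a b ys} → Path a b (a ∷ ys) → a ∷ ys at length ys ≡ b
  at-last [-]                       = refl
  at-last (step _ _ [-])            = refl
  at-last (step _ _ P@(step _ _ _)) = at-last P

  at-adjacent : ∀ {a b ys i} → Path a b (a ∷ ys) → i < length ys → a ∷ ys at i ~ a ∷ ys at suc i
  at-adjacent {i = zero}  (step a~ _ [-])           _   = a~
  at-adjacent {i = zero}  (step a~ _ (step _ _ _))  _   = a~
  at-adjacent {i = suc i} (step _ _ P@(step _ _ _)) i<  = at-adjacent P (s≤s⁻¹ i<)
  at-adjacent {i = suc i} (step _ _ [-])            (s≤s ())

  at-∈ : ∀ {a ys i} → i ≤ length ys → a ∷ ys at i ∈ a ∷ ys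
  at-∈ {i = zero}                _  = here refl
  at-∈ {ys = _ ∷ _} {i = suc i} i≤ = there (at-∈ (s≤s⁻¹ i≤))

  ∈-at : ∀ {a ys w} → w ∈ a ∷ ys → ∃[ i ] i ≤ length ys × a ∷ ys at i ≡ w
  ∈-at             (here refl) = 0 , z≤n , refl
  ∈-at {ys = _ ∷ _} (there w∈) with i , i≤ , e ← ∈-at w∈ = suc i , s≤s i≤ , e

  at-injective : ∀ {a ys i j} → Unique (a ∷ ys) → i ≤ length ys → j ≤ length ys →
                 a ∷ ys at i ≡ a ∷ ys at j → i ≡ j
  at-injective {i = zero}  {zero}  _ _ _ _ = refl
  at-injective {ys = _ ∷ _} {zero}  {suc j} u _  j≤ e =
    ⊥-elim (Unique[x∷xs]⇒x∉xs u (subst (_∈ _) (sym e) (at-∈ (s≤s⁻¹ j≤))))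
  at-injective {ys = _ ∷ _} {suc i} {zero}  u i≤ _  e =
    ⊥-elim (Unique[x∷xs]⇒x∉xs u (subst (_∈ _) e (at-∈ (s≤s⁻¹ i≤))))
  at-injective {ys = _ ∷ _} {suc i} {suc j} (_ ∷ u) i≤ j≤ e =
    cong suc (at-injective u (s≤s⁻¹ i≤) (s≤s⁻¹ j≤) e)

  avoiding-vertex : TwoConnected G → ∀ {w a b} → a ≢ w → b ≢ w → Star (AdjOutside G ⁅ w ⁆) a b
  avoiding-vertex (κ , ((_ , connected) , _) , 2≤κ) {w} a≢w b≢w =
    connected ⁅ w ⁆ (≤-trans (≤-reflexive (cong suc (∣⁅x⁆∣≡1 w))) 2≤κ) _ _ (x≢y⇒x∉⁅y⁆ a≢w) (x≢y⇒x∉⁅y⁆ b≢w)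

  -- Longest paths and the degree bound.

  module _ {p : ℕ} (path≤p : ∀ {a b xs} → Path a b xs → length xs ≤ p) where

    LongestPath : Fin n → Fin n → Set
    LongestPath x y = ∃[ xs ] Path x y xs × length xs ≡ p

    longest-reverse : ∀ {x y} → LongestPath x y → LongestPath y x
    longest-reverse (xs , P , e) = reverse xs , reversed P , ≡.trans (length-reverse xs) e

    longest-closed : ∀ {x y xs w} → Path x y xs → length xs ≡ p → x ~ w → w ∈ xs
    longest-closed {xs = xs} {w} P e x~w with _∈?_ _≟_ w xs
    ... | yes w∈ = w∈
    ... | no  w∉ = ⊥-elim (<⇒≱ (≤-reflexive (cong suc (sym e))) (path≤p (step (~-sym x~w) w∉ P)))

    longest-ends : ∀ {x y} → LongestPath x y →
                   ∃[ Z ] Unique Z × deg x ≤ length Z × y ∉ Z × (∀ {z} → z ∈ Z → LongestPath z y)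
    longest-ends ((x ∷ ys) , P , e) with refl ← path-head P with refl ← at-last P
      with Z , u , len , y∉ , ends ←
        rotation-ends (length ys) (x ∷ ys at_) (at-injective (path-unique P)) (at-adjacent P)
          (∈-at ∘ longest-closed P e) =
      Z , u , len , y∉ , λ z∈ → let xs , P′ , e′ = ends z∈ in xs , P′ , ≡.trans e′ e

    longest-path-closes : TwoConnected G → ∀ {x y c} → LongestPath x y → 0 < c →
                          (∀ {a b xs} → Path a b xs → b ~ a → length xs ≤ c) →
                          c < p → c < deg x + deg y → ⊥
    longest-path-closes 2-conn (x ∷ ys , P , refl) 0<c closed≤c c<p c<sum
      with refl ← path-head P with refl ← at-last P =
      long-closed-path (length ys) (x ∷ ys at_) (at-injective (path-unique P)) (at-adjacent P)
        (∈-at ∘ longest-closed P refl)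
        (λ y~w → ∈-at (reverse⁻ (longest-closed (reversed P) (length-reverse (x ∷ ys)) y~w)))
        (avoiding-vertex 2-conn) closed≤c c<p c<sum (≤-trans 0<c (s≤s⁻¹ c<p))

    -- Rotating at one end keeps the other, so extremality bounds the degrees of the new ends by
    -- that of the end replaced. On the side of `y`, the smaller end `x` counts as well, giving
    -- `deg y + 1` vertices of degree at most `deg y`.
    ordered-extremal-bound : ∀ {x y} → LongestPath x y → deg x ≤ deg y →
      (∀ {x′ y′} → LongestPath x′ y′ → deg x′ + deg y′ ≤ deg x + deg y) → degreeBound ≤ deg x + deg y
    ordered-extremal-bound {x} {y} L x≤y extremal
      with X , uX , lenX , _ , endsX ← longest-ends L
         | Y , uY , lenY , x∉Y , endsY ← longest-ends (longest-reverse L) =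
      bound (m≤n⇒m<n∨m≡n (δ≤degree y))
      where
      dδ≤x : d G (δ G) ≤ deg x
      dδ≤x = d-≤ (deg x) (δ G) uX
        (λ z∈ → +-cancelʳ-≤ (deg y) _ _ (extremal (endsX z∈))) (≤-trans (δ≤degree x) lenX)

      d≤y : ∀ k → k ≤ suc (length Y) → d G k ≤ deg y
      d≤y k = d-≤ (deg y) k (¬Any⇒All¬ Y x∉Y ∷ uY)
        λ { (here refl) → x≤y
          ; (there z∈)  → +-cancelˡ-≤ (deg x) _ _
              (subst (_≤ deg x + deg y) (+-comm _ (deg x)) (extremal (endsY z∈))) }

      bound : δ G < deg y ⊎ δ G ≡ deg y → degreeBound ≤ deg x + deg y
      bound (inj₁ δ<y) = ≤-trans (m⊓n≤m _ _) (+-mono-≤ dδ≤x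
        (d≤y (δ G + 2) (≤-trans (≤-reflexive (+-comm (δ G) 2)) (s≤s (≤-trans δ<y lenY)))))
      -- Now only `δ + 1` such vertices are assured, but both end degrees equal `δ`, so `deg y`
      -- bounds each half of `2 * d G (δ G + 1)`.
      bound (inj₂ δ≡y) = begin
        degreeBound                 ≤⟨ m⊓n≤n (d G (δ G) + d G (δ G + 2)) _ ⟩
        2 * d G (δ G + 1)      ≤⟨ *-monoʳ-≤ 2 (d≤y (δ G + 1) 1+δ≤) ⟩
        2 * deg y                   ≡⟨ cong (deg y +_) (+-identityʳ (deg y)) ⟩
        deg y + deg y               ≡⟨ cong (_+ deg y) x≡y ⟨
        deg x + deg y               ∎
        where
        open ≤-Reasoning
        1+δ≤ : δ G + 1 ≤ suc (length Y)
        1+δ≤ = ≤-trans (≤-reflexive (+-comm (δ G) 1)) (s≤s (≤-trans (δ≤degree y) lenY))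
        x≡y : deg x ≡ deg y
        x≡y = ≤-antisym x≤y (≤-trans (≤-reflexive (sym δ≡y)) (δ≤degree x))

    extremal-bound : ∀ {x y} → LongestPath x y →
      (∀ {x′ y′} → LongestPath x′ y′ → deg x′ + deg y′ ≤ deg x + deg y) → degreeBound ≤ deg x + deg y
    extremal-bound {x} {y} L extremal with ≤-total (deg x) (deg y)
    ... | inj₁ x≤y = ordered-extremal-bound L x≤y extremal
    ... | inj₂ y≤x = subst (degreeBound ≤_) (+-comm (deg y) (deg x))
      (ordered-extremal-bound (longest-reverse L) y≤x
        (λ L′ → ≤-trans (extremal L′) (≤-reflexive (+-comm (deg x) (deg y)))))

theorem4 : ∀ (n : ℕ) (G : Graph n) → TwoConnected G → δ G + 2 ≤ n →
    ∀ (c p : ℕ) → IsLongestCycleOrder G c → IsLongestPathOrder G p →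
    c ≥ p ⊓ ((d G (δ G) + d G (δ G + 2)) ⊓ (2 * d G (δ G + 1)))
theorem4 n G 2-conn _ c p ((_ , cycle 3≤ _ _ , refl) , cycle≤c) ((_ , path {v} u l , eq) , path≤p) =
  ≮⇒≥ λ c<min →
    -- End-degree sums are at most `n + n`, so a longest path with largest sum may be assumed.
    noMaximal {λ s → ∃[ x ] ∃[ y ] LongestPath G path≤p′ x y × degree G x + degree G y ≡ s} (n + n)
      (λ { (x , y , _ , refl) → +-mono-≤ (degree≤n G x) (degree≤n G y) })
      (λ { _ (x , y , L , refl) larger →
           longest-path-closes G path≤p′ 2-conn L (≤-trans (s≤s z≤n) 3≤) closed≤c
             (≤-trans c<min (m⊓n≤m p _))
             (≤-trans c<min (≤-trans (m⊓n≤n p _)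
               (extremal-bound G path≤p′ L λ L′ → ≮⇒≥ λ lt → larger lt (_ , _ , L′ , refl)))) })
      _ (v , proj₁ (toPath G u l) , (_ , proj₂ (toPath G u l) , eq) , refl)
  where
  path≤p′ : ∀ {a b xs} → Path G a b xs → length xs ≤ p
  path≤p′ P = path≤p _ (path⇒IsPath G P)

  closed≤c : ∀ {a b xs} → Path G a b xs → Adj G b a → length xs ≤ c
  closed≤c {xs = xs} P b~a with 3 ≤? length xs
  ... | yes 3≤xs = cycle≤c _ (path⇒IsCycle G P b~a 3≤xs)
  -- A closed path on fewer than three vertices is no cycle, but its order is below 3, and `c` is at
  -- least 3.
  ... | no  3≰xs = ≤-trans (<⇒≤ (≰⇒> 3≰xs)) 3≤
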